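{- The proof system $\mathrm{Res}^*(T)$ and the MCSAT proof system are equivalent with respect to their proof complexity on (quantifier-free) first-order logic with any theory $T$. That is, each system simulates the other: (1) MCSAT simulates $\mathrm{Res}^*(T)$: for any $\mathrm{Res}^*(T)$ proof, MCSAT can construct a proof that is at most polynomially longer; and (2) $\mathrm{Res}^*(T)$ simulates MCSAT: for any MCSAT proof, $\mathrm{Res}^*(T)$ can construct a proof that is at most polynomially longer.
   Context: **Basics.** The problem considered is the satisfiability of quantifier-free first-order formulas over a theory $T$, given in CNF, i.e. as sets of clauses. A literal $L$ is a theory constraint $c$ or its negation $\neg c$. A clause is a disjunction of literals; the empty clause is denoted $\mathit{false}$. $T\models C$ means that the clause $C$ is valid in $T$. The length of a proof is the number of proof rule applications in it (each application of any rule, including theory rules, counts as one step). The proof complexity of a derivability statement is the length of its shortest proof in the system. **The proof system $\mathrm{Res}^*(T)$.** It operates on a growing set (conjunction) of clauses $\varphi$, initially the input clauses, and consists of two rules. - Resolution: from $C\lor l$ and $D\lor\neg l$ derive $C\lor D$. - Strong Theory Derivation: from $\varphi$ derive $\varphi\wedge C$ if $T\models C$; here $C$ may contain literals not occurring in $\varphi$. (Regular Theory Derivation is the restriction of the second rule to clauses $C$ all of whose literals occur in $\varphi$.) There are no dedicated final states: UNSAT is implicitly derived if Resolution produces the empty clause, and SAT is implicitly derived if no new clauses can be derived with Resolution or (Regular) Theory Derivation, i.e. when a fixed point is reached. **The proof system MCSAT.** This is the model-constructing satisfiability calculus of de Moura and Jovanović with an added Restart rule. States are search states $\langle M,\mathcal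 C\rangle$, conflict states $\langle M,\mathcal C\rangle\Vdash C$, and the final states SAT and UNSAT. Here $\mathcal C$ is a set of clauses (initially the input clauses), $C$ is a clause (the conflict clause), and $M$ is a trail (initially empty), i.e. a list of Boolean decisions $L$, theory decisions $x\mapsto\alpha_x$ (theory variable $x$ is assigned the theory value $\alpha_x$), and Boolean or theory propagations $D\to L$ (literal $L$ is propagated with reason clause $D$). $\llbracket M,\dots\rrbracket$ denotes extension or concatenation of trails, and $\llbracket\rrbracket$ is the empty trail. Satisfiability is proven by deriving SAT, unsatisfiability by deriving UNSAT, starting from the empty trail and the input clauses. For a theory variable $x$, $\mathrm{value}(x,M)=\alpha_x$ if $x\mapsto\alpha_x$ is in $M$, and $\mathit{undef}$ otherwise. For a literal $L$, $\mathrm{value}(L,M)$ is $\mathit{true}$ if $L$ is decided or propagated in $M$, or if $L$ evaluates to true when the theory values from $M$ are substituted in $L$; it is $\mathit{false}$ if $\neg L$ is decided or propagated in $M$, or if $L$ evaluates to false under the theory assignments of $M$; and $\mathit{undef}$ otherwise. A clause has value $\mathit{false}$ if all its literals do. A trail is consistent if the Boolean and the theory evaluation of a constraint never contradict. A consistent trail $M$ is feasible if its theory variable assignments can be extended to satisfy all literals that are true in $M$; $\mathrm{infeasible}(M)$ means that $M$ is not feasible. A trail is complete if it assigns a Boolean value to each Boolean variable (theory constraint) or its negation, by Boolean decision or propagation, and a theory value to each theory variable. The system assumes the existence of a finite set $\mathit{Basis}$ of theory constraints such that all literals from all clauses, especially those returned by the function $\mathrm{explain}$, are contained in it. The function $\mathrm{explain}$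 explains theory propagations and infeasible states: for an infeasible trail $M$ it returns a valid theory lemma $E$ (so $T\models E$) explaining the infeasibility. $\mathrm{resolve}(C,D,L)$ is the result of propositional resolution of $C$ and $D$ with respect to $L$. The rules are as follows ($S\Longrightarrow S'$ means $S'$ may be derived from $S$ under the stated conditions). Boolean reasoning: - Decide: $\langle M,\mathcal C\rangle\Longrightarrow\langle\llbracket M,L\rrbracket,\mathcal C\rangle$ if $L\in\mathit{Basis}$ and $\mathrm{value}(L,M)=\mathit{undef}$. - Propagate: $\langle M,\mathcal C\rangle\Longrightarrow\langle\llbracket M,C\to L\rrbracket,\mathcal C\rangle$ if $C=(L_1\lor\dots\lor L_n\lor L)\in\mathcal C$, $\mathrm{value}(L_i,M)=\mathit{false}$ for all $i$, and $\mathrm{value}(L,M)=\mathit{undef}$. - Conflict: $\langle M,\mathcal C\rangle\Longrightarrow\langle M,\mathcal C\rangle\Vdash C$ if $C=(L_1\lor\dots\lor L_n)\in\mathcal C$ and $\mathrm{value}(L_i,M)=\mathit{false}$ for all $i$. - Sat: $\langle M,\mathcal C\rangle\Longrightarrow$ SAT if $M$ is complete and every clause in $\mathcal C$ has a literal with value $\mathit{true}$ in $M$. - Forget: $\langle M,\mathcal C\rangle\Longrightarrow\langle M,\mathcal C\setminus\{C\}\rangle$ if $C\in\mathcal C$ is a learned clause. - Restart: $\langle M,\mathcal C\rangle\Vdash C\Longrightarrow\langle\llbracket\rrbracket,\mathcal C\rangle$ (no condition). Conflict analysis: - Resolve: $\langle\llbracket M,D\to L\rrbracket,\mathcal C\rangle\Vdash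 C\Longrightarrow\langle M,\mathcal C\rangle\Vdash R$ if $\neg L\in C$ and $R=\mathrm{resolve}(C,D,L)$. - Consume$_1$: $\langle\llbracket M,D\to L\rrbracket,\mathcal C\rangle\Vdash C\Longrightarrow\langle M,\mathcal C\rangle\Vdash C$ if $\neg L\notin C$. - Consume$_2$: $\langle\llbracket M,L\rrbracket,\mathcal C\rangle\Vdash C\Longrightarrow\langle M,\mathcal C\rangle\Vdash C$ if $\neg L\notin C$. - Backjump: $\langle\llbracket M,N\rrbracket,\mathcal C\rangle\Vdash C\Longrightarrow\langle\llbracket M,C\to L\rrbracket,\mathcal C\rangle$ if $C=(L_1\lor\dots\lor L_n\lor L)$, $\mathrm{value}(L_i,M)=\mathit{false}$ for all $i$, $\mathrm{value}(L,M)=\mathit{undef}$, and $N$ starts with a decision. - Unsat: $\langle M,\mathcal C\rangle\Vdash\mathit{false}\Longrightarrow$ UNSAT. - Learn: $\langle M,\mathcal C\rangle\Vdash C\Longrightarrow\langle M,\mathcal C\cup\{C\}\rangle\Vdash C$ if $C\notin\mathcal C$. Theory reasoning: - T-Propagate: $\langle M,\mathcal C\rangle\Longrightarrow\langle\llbracket M,E\to L\rrbracket,\mathcal C\rangle$ if $L\in\mathit{Basis}$, $\mathrm{value}(L,M)=\mathit{undef}$, $\mathrm{infeasible}(\llbracket M,\neg L\rrbracket)$, and $E=\mathrm{explain}(\llbracket M,\neg L\rrbracket)$. - T-Decide: $\langle M,\mathcal C\rangle\Longrightarrow\langle\llbracket M,x\mapsto\alpha_x\rrbracket,\mathcal C\rangle$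 if $x$ is a theory variable in $\mathcal C$, $\mathrm{value}(x,M)=\mathit{undef}$, and $\llbracket M,x\mapsto\alpha_x\rrbracket$ is consistent. - T-Conflict: $\langle M,\mathcal C\rangle\Longrightarrow\langle M,\mathcal C\rangle\Vdash E$ if $\mathrm{infeasible}(M)$ and $E=\mathrm{explain}(M)$. - T-Consume: $\langle\llbracket M,x\mapsto\alpha_x\rrbracket,\mathcal C\rangle\Vdash C\Longrightarrow\langle M,\mathcal C\rangle\Vdash C$ if $\mathrm{value}(C,M)=\mathit{false}$. - T-Backjump-Decide: $\langle\llbracket M,x\mapsto\alpha_x,N\rrbracket,\mathcal C\rangle\Vdash C\Longrightarrow\langle\llbracket M,L\rrbracket,\mathcal C\rangle$ if $C=(L_1\lor\dots\lor L_n\lor L)$, $\mathrm{value}(L_i,M)=\mathit{undef}$ for some $i$, and $\mathrm{value}(L,M)=\mathit{undef}$. A learned clause is one that was added to $\mathcal C$ by Learn.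
   Formalization: Proofs are taken to be proofs of unsatisfiability, since for derivations of SAT both simulation claims fail; and literals without theory variables get a value only by decision or propagation, since otherwise MCSAT cannot refute an input clause such as {0=1}. -}

module Defs where

open import Data.Bool using (Bool; true; false; not)
open import Data.List using (List; []; _∷_; _++_; concatMap; filter; foldr)
open import Data.List.Membership.Propositional using (_∈_; _∉_)
import Data.List.Membership.Setoid as SetoidMembership
open import Data.List.Relation.Binary.BagAndSetEquality using ([_]-Equality; set; _∼[_]_)
open import Data.List.Relation.Unary.All using (All)
open import Data.List.Relation.Unary.Any using (Any; _─_)
open import Data.Maybe using (Maybe; just; nothing; Is-just)
open import Data.Nat using (ℕ; suc; _+_; _*_)
import Data.Nat as ℕ
open import Data.Product using (Σ; ∃-syntax; _×_; _,_)
open import Data.Sum using (_⊎_)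
open import Data.Vec using (Vec; []; _∷_)
open import Level using (Level; _⊔_; 0ℓ) renaming (suc to lsuc)
open import Relation.Binary.Construct.Closure.ReflexiveTransitive using (Star; ε; _◅_)
open import Relation.Binary.Definitions using (DecidableEquality)
open import Relation.Binary.PropositionalEquality using (_≡_; _≢_; refl)
open import Relation.Nullary using (¬_; ¬?; Dec; yes; no)

-- Coefficients, constant term first.

Polynomial : Set
Polynomial = List ℕ

evalPoly : Polynomial → ℕ → ℕ
evalPoly p x = foldr (λ a r → a + x * r) 0 p

proofLength : ∀ {i r} {I : Set i} {R : I → I → Set r} {x y : I} → Star R x y → ℕ
proofLength ε        = 0
proofLength (_ ◅ xs) = suc (proofLength xs)

record Signature : Set₁ where
  field
    Fun    : Set
    Pred   : Set
    arityᶠ : Fun → ℕ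
    arityᵖ : Pred → ℕ
    _≟ᶠ_   : DecidableEquality Fun
    _≟ᵖ_   : DecidableEquality Pred

-- Equality, where a theory has it, is a predicate
-- symbol that the models of the theory interpret as identity.

module Syntax (S : Signature) where
  open Signature S

  Var : Set
  Var = ℕ

  data Term : Set where
    var : Var → Term
    app : (f : Fun) → Vec Term (arityᶠ f) → Term

  data Constraint : Set where
    rel : (P : Pred) → Vec Term (arityᵖ P) → Constraint

  data Literal : Set where
    pos neg : Constraint → Literal

  constraint : Literal → Constraint
  constraint (pos c) = c
  constraint (neg c) = c

  infix 8 ~_

  ~_ : Literal → Literal
  ~ (pos c) = neg c
  ~ (neg c) = pos c

  -- Clauses are finite sets of literals: lists, compared by _≈_ below.

  Clause : Set
  Clause = List Literal

  infix 4 _≈_ _∈ᶜ_ _∉ᶜ_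

  _≈_ : Clause → Clause → Set
  C ≈ D = C ∼[ set ] D

  _∈ᶜ_ _∉ᶜ_ : Clause → List Clause → Set
  _∈ᶜ_ = SetoidMembership._∈_ ([ set ]-Equality Literal)
  _∉ᶜ_ = SetoidMembership._∉_ ([ set ]-Equality Literal)

  varsᵗ  : Term → List Var
  varsᵗˢ : ∀ {n} → Vec Term n → List Var
  varsᵗ (var x)    = x ∷ []
  varsᵗ (app _ ts) = varsᵗˢ ts
  varsᵗˢ []        = []
  varsᵗˢ (t ∷ ts)  = varsᵗ t ++ varsᵗˢ ts

  varsᵃ : Constraint → List Var
  varsᵃ (rel _ ts) = varsᵗˢ ts

  vars : Literal → List Var
  vars L = varsᵃ (constraint L)

  varsᶜ : Clause → List Var
  varsᶜ = concatMap vars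

  infix 4 _≟ᵗ_ _≟ᵗˢ_ _≟ᵃ_ _≟_

  _≟ᵗ_  : DecidableEquality Term
  _≟ᵗˢ_ : ∀ {n} → DecidableEquality (Vec Term n)

  var x    ≟ᵗ var y with x ℕ.≟ y
  ... | yes refl = yes refl
  ... | no x≢y   = no λ { refl → x≢y refl }
  var _    ≟ᵗ app _ _ = no λ ()
  app _ _  ≟ᵗ var _   = no λ ()
  app f ts ≟ᵗ app g us with f ≟ᶠ g
  ... | no f≢g   = no λ { refl → f≢g refl }
  ... | yes refl with ts ≟ᵗˢ us
  ...   | yes refl = yes refl
  ...   | no ts≢us = no λ { refl → ts≢us refl }

  []       ≟ᵗˢ []       = yes refl
  (t ∷ ts) ≟ᵗˢ (u ∷ us) with t ≟ᵗ u | ts ≟ᵗˢ us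
  ... | yes refl | yes refl = yes refl
  ... | no t≢u   | _        = no λ { refl → t≢u refl }
  ... | yes _    | no ts≢us = no λ { refl → ts≢us refl }

  _≟ᵃ_ : DecidableEquality Constraint
  rel P ts ≟ᵃ rel Q us with P ≟ᵖ Q
  ... | no P≢Q   = no λ { refl → P≢Q refl }
  ... | yes refl with ts ≟ᵗˢ us
  ...   | yes refl = yes refl
  ...   | no ts≢us = no λ { refl → ts≢us refl }

  _≟_ : DecidableEquality Literal
  pos c ≟ pos d with c ≟ᵃ d
  ... | yes refl = yes refl
  ... | no c≢d   = no λ { refl → c≢d refl }
  pos _ ≟ neg _ = no λ ()
  neg _ ≟ pos _ = no λ ()
  neg c ≟ neg d with c ≟ᵃ d
  ... | yes refl = yes refl
  ... | no c≢d   = no λ { refl → c≢d refl }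

  infixl 6 _∖_

  _∖_ : Clause → Literal → Clause
  C ∖ L = filter (λ K → ¬? (K ≟ L)) C

  -- The propositional resolvent of C (containing ~ L) and D (containing L).

  resolve : Clause → Clause → Literal → Clause
  resolve C D L = (C ∖ ~ L) ++ (D ∖ L)

-- A structure also interprets the theory values, which act as names for
-- elements of its carrier.  For a theory given by one fixed structure one takes
-- Value = Carrier and val the identity.

record Structure (S : Signature) (Value : Set) : Set₁ where
  open Signature S
  field
    Carrier : Set
    ⟦_⟧ᶠ    : (f : Fun) → Vec Carrier (arityᶠ f) → Carrier
    ⟦_⟧ᵖ    : (P : Pred) → Vec Carrier (arityᵖ P) → Bool
    val     : Value → Carrier

  open Syntax S

  Assignment : Set
  Assignment = Var → Carrier

  evalᵗ  : Assignment → Term → Carrier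
  evalᵗˢ : ∀ {n} → Assignment → Vec Term n → Vec Carrier n
  evalᵗ  v (var x)    = v x
  evalᵗ  v (app f ts) = ⟦ f ⟧ᶠ (evalᵗˢ v ts)
  evalᵗˢ v []         = []
  evalᵗˢ v (t ∷ ts)   = evalᵗ v t ∷ evalᵗˢ v ts

  evalᵃ : Assignment → Constraint → Bool
  evalᵃ v (rel P ts) = ⟦ P ⟧ᵖ (evalᵗˢ v ts)

  eval : Assignment → Literal → Bool
  eval v (pos c) = evalᵃ v c
  eval v (neg c) = not (evalᵃ v c)

-- A theory is an arbitrary class of structures.

record Theory (S : Signature) (ℓ : Level) : Set (lsuc (lsuc 0ℓ ⊔ ℓ)) where
  field
    Value   : Set
    IsModel : Structure S Value → Set ℓ

module ProofSystems {S : Signature} {ℓ : Level} (T : Theory S ℓ) where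
  open Syntax S public
  open Theory T public
  open Structure

  infix 4 T⊨_

  T⊨_ : Clause → Set (lsuc 0ℓ ⊔ ℓ)
  T⊨ C = ∀ A → IsModel A → (v : Assignment A) → Any (λ L → eval A v L ≡ true) C

  infix 4 _⊢_ _⊢*_

  data _⊢_ (φ : List Clause) : List Clause → Set (lsuc 0ℓ ⊔ ℓ) where

    resolution : ∀ {C D l} →
      (l ∷ C) ∈ᶜ φ → (~ l ∷ D) ∈ᶜ φ →
      φ ⊢ (C ++ D) ∷ φ

    strong-theory-derivation : ∀ {C} →
      T⊨ C →
      φ ⊢ C ∷ φ

  _⊢*_ : List Clause → List Clause → Set (lsuc 0ℓ ⊔ ℓ)
  _⊢*_ = Star _⊢_

  data Entry : Set where
    decide    : Literal → Entry
    propagate : Clause → Literal → Entry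
    _↦_       : Var → Value → Entry

  -- The most recent entry is the head, so ⟦ M , N ⟧ is N ++ M.

  Trail : Set
  Trail = List Entry

  data IsDecision : Entry → Set where
    boolean : ∀ {L} → IsDecision (decide L)
    theory  : ∀ {x α} → IsDecision (x ↦ α)

  data Asserts (L : Literal) : Entry → Set where
    decided    : Asserts L (decide L)
    propagated : ∀ {D} → Asserts L (propagate D L)

  Asserted : Trail → Literal → Set
  Asserted M L = Any (Asserts L) M

  valueᵛ : Var → Trail → Maybe Value
  valueᵛ x []                    = nothing
  valueᵛ x (decide _ ∷ M)        = valueᵛ x M
  valueᵛ x (propagate _ _ ∷ M)   = valueᵛ x M
  valueᵛ x ((y ↦ α) ∷ M) with x ℕ.≟ y
  ... | yes _ = just α
  ... | no  _ = valueᵛ x M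

  Extends : (A : Structure S Value) → Assignment A → Trail → Set
  Extends A v M = ∀ {x α} → valueᵛ x M ≡ just α → v x ≡ val A α

  -- Substituting the values of M in L leaves no variable and yields b in T.
  -- A literal without theory variables is not subject to substitution: like a
  -- Boolean variable, it only gets a value by decision or propagation.

  Evaluates : Trail → Literal → Bool → Set (lsuc 0ℓ ⊔ ℓ)
  Evaluates M L b =
    vars L ≢ [] ×
    All (λ x → Is-just (valueᵛ x M)) (vars L) ×
    (∀ A → IsModel A → (v : Assignment A) → Extends A v M → eval A v L ≡ b)

  -- value(L,M) = true, false, undef; predicates rather than a function since
  -- evaluation in an arbitrary theory need not be decidable.

  IsTrue IsFalse IsUndef : Trail → Literal → Set (lsuc 0ℓ ⊔ ℓ)
  IsTrue  M L = Asserted M L ⊎ Evaluates M L true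
  IsFalse M L = Asserted M (~ L) ⊎ Evaluates M L false
  IsUndef M L = ¬ IsTrue M L × ¬ IsFalse M L

  Consistent : Trail → Set (lsuc 0ℓ ⊔ ℓ)
  Consistent M = ∀ L → ¬ (Asserted M L × Evaluates M L false)

  Feasible : Trail → Set (lsuc 0ℓ ⊔ ℓ)
  Feasible M =
    Consistent M ×
    ∃[ A ] IsModel A × Σ (Assignment A) λ v →
      Extends A v M × (∀ L → IsTrue M L → eval A v L ≡ true)

  Infeasible : Trail → Set (lsuc 0ℓ ⊔ ℓ)
  Infeasible M = ¬ Feasible M

  Complete : List Clause → Trail → Set
  Complete 𝒞 M =
    All (All λ L → Asserted M L ⊎ Asserted M (~ L)) 𝒞 ×
    All (λ C → All (λ x → Is-just (valueᵛ x M)) (varsᶜ C)) 𝒞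

  infix 4 _∈ᴮ_

  _∈ᴮ_ : Literal → List Constraint → Set
  L ∈ᴮ Basis = constraint L ∈ Basis

  Covers : List Constraint → List Clause → Set
  Covers Basis 𝒞 = All (All (_∈ᴮ Basis)) 𝒞

  record Explanation (Basis : List Constraint) : Set (lsuc 0ℓ ⊔ ℓ) where
    field
      explain : Trail → Clause
      explains : ∀ M → (∀ L → Asserted M L → L ∈ᴮ Basis) → Infeasible M →
        (T⊨ explain M) ×
        All (IsFalse M) (explain M) ×
        All (_∈ᴮ Basis) (explain M)

  -- The clause set of a state is input ++ 𝓛, where 𝓛 holds the learned clauses.

  data State : Set where
    ⟨_,_⟩    : Trail → List Clause → State
    ⟨_,_⟩⊩_  : Trail → List Clause → Clause → State
    SAT UNSAT : State

  module MCSAT (input : List Clause) (Basis : List Constraint) (X : Explanation Basis) where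
    open Explanation X

    clauses : List Clause → List Clause
    clauses 𝓛 = input ++ 𝓛

    infix 4 _⟹_ _⟹*_

    data _⟹_ : State → State → Set (lsuc 0ℓ ⊔ ℓ) where

      Decide : ∀ {M 𝓛 L} →
        L ∈ᴮ Basis → IsUndef M L →
        ⟨ M , 𝓛 ⟩ ⟹ ⟨ decide L ∷ M , 𝓛 ⟩

      Propagate : ∀ {M 𝓛 Ls L} →
        (L ∷ Ls) ∈ᶜ clauses 𝓛 → All (IsFalse M) Ls → IsUndef M L →
        ⟨ M , 𝓛 ⟩ ⟹ ⟨ propagate (L ∷ Ls) L ∷ M , 𝓛 ⟩

      Conflict : ∀ {M 𝓛 C} →
        C ∈ᶜ clauses 𝓛 → All (IsFalse M) C →
        ⟨ M , 𝓛 ⟩ ⟹ ⟨ M , 𝓛 ⟩⊩ C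

      Sat : ∀ {M 𝓛} →
        Complete (clauses 𝓛) M → All (Any (IsTrue M)) (clauses 𝓛) →
        ⟨ M , 𝓛 ⟩ ⟹ SAT

      Forget : ∀ {M 𝓛 C} →
        (C∈𝓛 : C ∈ᶜ 𝓛) →
        ⟨ M , 𝓛 ⟩ ⟹ ⟨ M , 𝓛 ─ C∈𝓛 ⟩

      Restart : ∀ {M 𝓛 C} →
        ⟨ M , 𝓛 ⟩⊩ C ⟹ ⟨ [] , 𝓛 ⟩

      Resolve : ∀ {M 𝓛 C D L} →
        ~ L ∈ C →
        ⟨ propagate D L ∷ M , 𝓛 ⟩⊩ C ⟹ ⟨ M , 𝓛 ⟩⊩ resolve C D L

      Consume₁ : ∀ {M 𝓛 C D L} →
        ~ L ∉ C →
        ⟨ propagate D L ∷ M , 𝓛 ⟩⊩ C ⟹ ⟨ M , 𝓛 ⟩⊩ C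

      Consume₂ : ∀ {M 𝓛 C L} →
        ~ L ∉ C →
        ⟨ decide L ∷ M , 𝓛 ⟩⊩ C ⟹ ⟨ M , 𝓛 ⟩⊩ C

      -- The segment that starts with the decision d is ⟦ d , N ⟧.
      Backjump : ∀ {M N d 𝓛 C Ls L} →
        IsDecision d →
        C ≈ L ∷ Ls → All (IsFalse M) Ls → IsUndef M L →
        ⟨ N ++ d ∷ M , 𝓛 ⟩⊩ C ⟹ ⟨ propagate C L ∷ M , 𝓛 ⟩

      Unsat : ∀ {M 𝓛} →
        ⟨ M , 𝓛 ⟩⊩ [] ⟹ UNSAT

      Learn : ∀ {M 𝓛 C} →
        C ∉ᶜ clauses 𝓛 →
        ⟨ M , 𝓛 ⟩⊩ C ⟹ ⟨ M , C ∷ 𝓛 ⟩⊩ C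

      T-Propagate : ∀ {M 𝓛 L} →
        L ∈ᴮ Basis → IsUndef M L → Infeasible (decide (~ L) ∷ M) →
        ⟨ M , 𝓛 ⟩ ⟹ ⟨ propagate (explain (decide (~ L) ∷ M)) L ∷ M , 𝓛 ⟩

      T-Decide : ∀ {M 𝓛 x α} →
        Any (λ C → x ∈ varsᶜ C) (clauses 𝓛) →
        valueᵛ x M ≡ nothing → Consistent ((x ↦ α) ∷ M) →
        ⟨ M , 𝓛 ⟩ ⟹ ⟨ (x ↦ α) ∷ M , 𝓛 ⟩

      T-Conflict : ∀ {M 𝓛} →
        Infeasible M →
        ⟨ M , 𝓛 ⟩ ⟹ ⟨ M , 𝓛 ⟩⊩ explain M

      T-Consume : ∀ {M 𝓛 C x α} →
        All (IsFalse M) C →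
        ⟨ (x ↦ α) ∷ M , 𝓛 ⟩⊩ C ⟹ ⟨ M , 𝓛 ⟩⊩ C

      -- L ∉ Ls: the literal L_i of undefined value is one other than L.
      T-Backjump-Decide : ∀ {M N 𝓛 C x α Ls L} →
        C ≈ L ∷ Ls → L ∉ Ls → Any (IsUndef M) Ls → IsUndef M L →
        ⟨ N ++ (x ↦ α) ∷ M , 𝓛 ⟩⊩ C ⟹ ⟨ decide L ∷ M , 𝓛 ⟩

    _⟹*_ : State → State → Set (lsuc 0ℓ ⊔ ℓ)
    _⟹*_ = Star _⟹_

  Res*Proof : List Clause → Set (lsuc 0ℓ ⊔ ℓ)
  Res*Proof φ = ∃[ ψ ] (φ ⊢* ψ) × [] ∈ᶜ ψ

  Res*Length : ∀ {φ} → Res*Proof φ → ℕ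
  Res*Length (_ , π , _) = proofLength π

  -- Clause sets only grow, so the last one contains all clauses of the proof.

  Res*Clauses : ∀ {φ} → Res*Proof φ → List Clause
  Res*Clauses (ψ , _) = ψ

  MCSATProof : (φ : List Clause) (Basis : List Constraint) → Explanation Basis → Set (lsuc 0ℓ ⊔ ℓ)
  MCSATProof φ Basis X = ⟨ [] , [] ⟩ ⟹* UNSAT
    where open MCSAT φ Basis X

  MCSATLength : ∀ {φ Basis X} → MCSATProof φ Basis X → ℕ
  MCSATLength = proofLength

{-# OPTIONS --safe #-}

-- Res*(T) simulated by MCSAT: every resolution step removes at most one literal,
-- so a clause that matters for deriving the empty clause in k further steps has
-- at most k distinct literals, however large the other clauses are.  Such a
-- clause, unless it is a tautology, is replaced by a learned clause subsuming it:
-- decide the negations of all its literals, reach a conflict (by T-Conflict for a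
-- theory lemma, by Propagate, Conflict and Resolve for a resolvent), learn, restart.
--
-- MCSAT simulated by Res*(T): every clause of a search state is derivable, and a
-- step introduces at most one new clause.  T-Propagate may give a reason E for L
-- with L ∉ E; resolving with it yields a superset of E, hence a valid clause.

module Submission where

open import Defs
open import Data.Bool using (not; true)
open import Data.List using (List; []; _∷_; _++_; deduplicate; length; map)
open import Data.List.Membership.Propositional using (_∈_; _∉_; find; lose)
open import Data.List.Membership.Propositional.Properties
  using (∈-++⁺ˡ; ∈-++⁺ʳ; ∈-++⁻; ∈-deduplicate⁺; ∈-deduplicate⁻; ∈-filter⁺; ∈-filter⁻)
open import Data.List.Properties using (length-removeAt′)
import Data.List.Relation.Binary.BagAndSetEquality as SetEquality
open import Data.List.Relation.Binary.Subset.Propositional using (_⊆_)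
open import Data.List.Relation.Binary.Subset.Propositional.Properties
  using (∷⁺ʳ; ++⁺ʳ; ⊆∷∧∉⇒⊆; xs⊆xs++ys; xs⊆ys++xs; Any-resp-⊆; All-resp-⊇)
open import Data.List.Relation.Unary.All as All using (All; []; _∷_)
open import Data.List.Relation.Unary.All.Properties as All using (All¬⇒¬Any)
open import Data.List.Relation.Unary.AllPairs using ([]; _∷_)
open import Data.List.Relation.Unary.Any as Any using (Any; here; there; _─_)
import Data.List.Relation.Unary.Any.Properties as Any
open import Data.List.Relation.Unary.Unique.Propositional using (Unique)
import Data.List.Relation.Unary.Unique.DecPropositional.Properties as Unique
open import Data.Maybe using (Is-just; nothing)
open import Data.Nat using (ℕ; suc; _+_; _*_; _≤_; _≤?_; z≤n; s≤s)
open import Data.Nat.Properties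
  using (+-comm; +-mono-≤; +-monoʳ-≤; +-monoˡ-≤; m≤m+n; m≤n+m; m≤n⇒m≤1+n; ≤-refl; ≤-trans)
open import Data.Nat.Tactic.RingSolver using (solve-∀)
open import Data.Product using (Σ; _×_; _,_; ∃-syntax; proj₁; proj₂)
open import Data.Sum as Sum using (_⊎_; inj₁; inj₂)
open import Function using (_∘_; id; mk⇔; Equivalence)
open import Level using (Level; _⊔_; 0ℓ) renaming (suc to lsuc)
open import Relation.Binary.Bundles using (module Setoid)
open import Relation.Binary.Construct.Closure.ReflexiveTransitive using (Star; ε; _◅_; _◅◅_)
open import Relation.Binary.PropositionalEquality
  using (_≡_; _≢_; refl; sym; trans; cong; subst)
open import Relation.Nullary using (¬_; ¬?; Dec; yes; no; contradiction)
open import Relation.Nullary.Decidable using (_×-dec_; map′)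

-- Lengths of composed proofs and of duplicate-free lists.

proofLength-◅◅ : ∀ {i r} {I : Set i} {R : I → I → Set r} {x y z : I}
  (xs : Star R x y) (ys : Star R y z) →
  proofLength (xs ◅◅ ys) ≡ proofLength xs + proofLength ys
proofLength-◅◅ ε        ys = refl
proofLength-◅◅ (_ ◅ xs) ys = cong suc (proofLength-◅◅ xs ys)

module _ {a} {A : Set a} where

  ∈-─⁺ : ∀ {x y : A} {xs} (x∈xs : x ∈ xs) → y ∈ xs → y ≢ x → y ∈ (xs ─ x∈xs)
  ∈-─⁺ (here refl)  (here refl)  y≢x = contradiction refl y≢x
  ∈-─⁺ (here refl)  (there y∈xs) y≢x = y∈xs
  ∈-─⁺ (there x∈xs) (here refl)  y≢x = here refl
  ∈-─⁺ (there x∈xs) (there y∈xs) y≢x = there (∈-─⁺ x∈xs y∈xs y≢x)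

  -- Pigeonhole: each element of `xs` uses up one position of `ys`, and since the rest of `xs`
  -- avoids that element, it still embeds into `ys` after the removal.
  Unique-⊆⇒length≤ : ∀ {xs ys : List A} → Unique xs → xs ⊆ ys → length xs ≤ length ys
  Unique-⊆⇒length≤ []            _     = z≤n
  Unique-⊆⇒length≤ {x ∷ xs} {ys} (x∉xs ∷ xs!) xs⊆ys =
    subst (suc (length xs) ≤_) (sym (length-removeAt′ ys (Any.index x∈ys)))
      (s≤s (Unique-⊆⇒length≤ xs! λ y∈xs →
        ∈-─⁺ x∈ys (xs⊆ys (there y∈xs)) λ { refl → All¬⇒¬Any x∉xs y∈xs }))
    where x∈ys = xs⊆ys (here refl)

-- Clauses as finite sets: distinct literals, tautologies and subsumption.

module ClauseProperties (S : Signature) where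
  open Syntax S
  open import Data.List.Membership.DecPropositional _≟_ using (_∈?_) public
  open import Data.List.Relation.Binary.Subset.DecPropositional _≟_ using (_⊆?_)
  open Setoid (SetEquality.[ SetEquality.set ]-Equality Literal) public
    using () renaming (refl to ≈-refl; sym to ≈-sym; trans to ≈-trans)

  ~-involutive : ∀ L → ~ ~ L ≡ L
  ~-involutive (pos _) = refl
  ~-involutive (neg _) = refl

  ~-injective : ∀ {K L} → ~ K ≡ ~ L → K ≡ L
  ~-injective {K} {L} ~K≡~L =
    trans (sym (~-involutive K)) (trans (cong ~_ ~K≡~L) (~-involutive L))

  ~-irrefl : ∀ {L} → ~ L ≢ L
  ~-irrefl {pos _} ()
  ~-irrefl {neg _} ()

  constraint-~ : ∀ L → constraint (~ L) ≡ constraint L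
  constraint-~ (pos _) = refl
  constraint-~ (neg _) = refl

  ≈⇒⊆ : ∀ {C D : Clause} → C ≈ D → C ⊆ D
  ≈⇒⊆ C≈D = Equivalence.to C≈D

  ≈⇒⊇ : ∀ {C D : Clause} → C ≈ D → D ⊆ C
  ≈⇒⊇ C≈D = Equivalence.from C≈D

  ⊆-antisym : ∀ {C D : Clause} → C ⊆ D → D ⊆ C → C ≈ D
  ⊆-antisym C⊆D D⊆C = mk⇔ C⊆D D⊆C

  _≈?_ : ∀ C D → Dec (C ≈ D)
  C ≈? D = map′ to from ((C ⊆? D) ×-dec (D ⊆? C))
    where
    to : C ⊆ D × D ⊆ C → C ≈ D
    to (C⊆D , D⊆C) = ⊆-antisym {C} {D} C⊆D D⊆C
    from : C ≈ D → C ⊆ D × D ⊆ C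
    from C≈D = ≈⇒⊆ {C} C≈D , ≈⇒⊇ {C} C≈D

  -- Makes the side condition of `Learn` decidable, so that a run can be constructed by cases on it.
  _∈ᶜ?_ : ∀ C 𝒞 → Dec (C ∈ᶜ 𝒞)
  C ∈ᶜ? 𝒞 = Any.any? (C ≈?_) 𝒞

  ∈⇒∈ᶜ : ∀ {C 𝒞} → C ∈ 𝒞 → C ∈ᶜ 𝒞
  ∈⇒∈ᶜ = Any.map λ { {D} refl → ≈-refl {D} }

  ∈ᶜ-resp-≈ : ∀ {C D 𝒞} → C ≈ D → C ∈ᶜ 𝒞 → D ∈ᶜ 𝒞
  ∈ᶜ-resp-≈ {C} {D} C≈D =
    Any.map λ {E} → ≈-trans {D} {C} {E} (≈-sym {C} {D} C≈D)

  ∈-∖⁺ : ∀ {C K L} → K ∈ C → K ≢ L → K ∈ C ∖ L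
  ∈-∖⁺ {L = L} = ∈-filter⁺ (λ K → ¬? (K ≟ L))

  ∈-∖⁻ : ∀ {C K L} → K ∈ C ∖ L → K ∈ C × K ≢ L
  ∈-∖⁻ {C} {L = L} = ∈-filter⁻ (λ K → ¬? (K ≟ L)) {xs = C}

  ∖⊆ : ∀ C L → C ∖ L ⊆ C
  ∖⊆ C L = proj₁ ∘ ∈-∖⁻ {C}

  ⊆∷∖ : ∀ C L → C ⊆ L ∷ (C ∖ L)
  ⊆∷∖ C L {K} K∈C with K ≟ L
  ... | yes refl = here refl
  ... | no K≢L   = there (∈-∖⁺ K∈C K≢L)

  ≈∷∖ : ∀ {C L} → L ∈ C → C ≈ L ∷ (C ∖ L)
  ≈∷∖ {C} {L} L∈C = ⊆-antisym (⊆∷∖ C L) λ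
    { (here refl) → L∈C ; (there K∈C∖L) → ∖⊆ C L K∈C∖L }

  ⊆∷⇒∖⊆ : ∀ {C D : Clause} {L} → C ⊆ L ∷ D → C ∖ L ⊆ D
  ⊆∷⇒∖⊆ {C} C⊆L∷D K∈C∖L with ∈-∖⁻ {C} K∈C∖L
  ... | K∈C , K≢L with C⊆L∷D K∈C
  ...   | here K≡L  = contradiction K≡L K≢L
  ...   | there K∈D = K∈D

  support : Clause → Clause
  support = deduplicate _≟_

  support! : ∀ C → Unique (support C)
  support! = Unique.deduplicate-! _≟_

  ⊆support : ∀ C → C ⊆ support C
  ⊆support C = ∈-deduplicate⁺ _≟_

  support⊆ : ∀ C → support C ⊆ C
  support⊆ C = ∈-deduplicate⁻ _≟_ C

  -- Repetitions must not count: `resolution` concatenates lists, and clauses are compared only up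
  -- to `≈`.
  size : Clause → ℕ
  size C = length (support C)

  size-mono : ∀ {C D} → C ⊆ D → size C ≤ size D
  size-mono {C} {D} C⊆D =
    Unique-⊆⇒length≤ (support! C) (⊆support D ∘ C⊆D ∘ support⊆ C)

  size-∷ : ∀ L C → size (L ∷ C) ≤ suc (size C)
  size-∷ L C =
    Unique-⊆⇒length≤ (support! (L ∷ C)) (∷⁺ʳ L (⊆support C) ∘ support⊆ (L ∷ C))

  Tautology : Clause → Set
  Tautology C = ∃[ L ] L ∈ C × ~ L ∈ C

  tautology? : ∀ C → Dec (Tautology C)
  tautology? C = map′ find (λ (_ , L∈C , ~L∈C) → lose L∈C ~L∈C)
    (Any.any? (λ L → ~ L ∈? C) C)

  tautology-mono : ∀ {C D} → C ⊆ D → Tautology C → Tautology D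
  tautology-mono C⊆D (L , L∈C , ~L∈C) = L , C⊆D L∈C , C⊆D ~L∈C

  tautology-∷ : ∀ {L C} → Tautology (L ∷ C) → Tautology C ⊎ ~ L ∈ C
  tautology-∷ (K , here refl  , here ~K≡K)  = contradiction ~K≡K ~-irrefl
  tautology-∷ (K , here refl  , there ~K∈C) = inj₂ ~K∈C
  tautology-∷ (K , there K∈C  , here refl)  =
    inj₂ (subst (_∈ _) (sym (~-involutive K)) K∈C)
  tautology-∷ (K , there K∈C  , there ~K∈C) = inj₁ (K , K∈C , ~K∈C)

  -- Subsumption rather than membership, because `explain` and `Resolve` may yield a stronger clause
  -- than the intended one. Tautologies are set apart, because the complements of their literals
  -- cannot all be decided.
  Redundant : List Clause → Clause → Set
  Redundant 𝒞 C = Tautology C ⊎ Any (_⊆ C) 𝒞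

  redundant-mono : ∀ {𝒞 C D} → C ⊆ D → Redundant 𝒞 C → Redundant 𝒞 D
  redundant-mono C⊆D (inj₁ taut) = inj₁ (tautology-mono C⊆D taut)
  redundant-mono C⊆D (inj₂ E∈)   = inj₂ (Any.map (λ E⊆C {K} → C⊆D ∘ E⊆C {K}) E∈)

  redundant-⊆ : ∀ {𝒞 𝒟 C} → 𝒞 ⊆ 𝒟 → Redundant 𝒞 C → Redundant 𝒟 C
  redundant-⊆ 𝒞⊆𝒟 = Sum.map id (Any-resp-⊆ 𝒞⊆𝒟)

-- From Res*(T) to MCSAT: trails that decide the negation of a clause.

module MCSATSimulatesRes* {ℓ : Level} {S : Signature} (T : Theory S ℓ) where
  open ProofSystems T
  open ClauseProperties S
  open Structure

  eval-~ : ∀ (A : Structure S Value) (v : Assignment A) L → eval A v L ≡ true → eval A v (~ L) ≢ true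
  eval-~ A v (pos c) L-true ~L-true = contradiction (trans (sym ~L-true) (cong not L-true)) λ ()
  eval-~ A v (neg c) L-true ~L-true = contradiction (trans (sym L-true) (cong not ~L-true)) λ ()

  refute : Clause → Trail
  refute = map (decide ∘ ~_)

  refute-unassigned : ∀ x C → valueᵛ x (refute C) ≡ nothing
  refute-unassigned x []      = refl
  refute-unassigned x (_ ∷ C) = refute-unassigned x C

  -- The trail holds no theory decision, so no variable has a value; literals without variables are
  -- excluded by the first component of `Evaluates`. Hence truth values on such a trail come from
  -- decisions alone.
  refute-¬evaluates : ∀ {C L b} → ¬ Evaluates (refute C) L b
  refute-¬evaluates {C} {L} (vars≢[] , assigned , _) with vars L
  ... | []    = vars≢[] refl
  ... | x ∷ _ with assigned
  ...   | x-assigned ∷ _ with subst Is-just (refute-unassigned x C) x-assigned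
  ...     | ()

  refute-asserts⁺ : ∀ {C L} → L ∈ C → Asserted (refute C) (~ L)
  refute-asserts⁺ (here refl) = here decided
  refute-asserts⁺ (there L∈C) = there (refute-asserts⁺ L∈C)

  asserts-decide⁻ : ∀ {K L} → Asserts L (decide K) → K ≡ L
  asserts-decide⁻ decided = refl

  refute-asserts⁻ : ∀ {C L} → Asserted (refute C) (~ L) → L ∈ C
  refute-asserts⁻ {C} asserted with find (Any.map⁻ asserted)
  ... | K , K∈C , asserts = subst (_∈ C) (~-injective (asserts-decide⁻ asserts)) K∈C

  refute-false⁻ : ∀ {C L} → IsFalse (refute C) L → L ∈ C
  refute-false⁻         (inj₁ asserted)  = refute-asserts⁻ asserted
  refute-false⁻ {C} {L} (inj₂ evaluates) = contradiction evaluates (refute-¬evaluates {C} {L})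

  refute-undef : ∀ {C L} → L ∉ C → ~ L ∉ C → IsUndef (refute C) L
  refute-undef {C} {L} L∉C ~L∉C = ¬true , L∉C ∘ refute-false⁻
    where
    ¬true : ¬ IsTrue (refute C) L
    ¬true (inj₁ asserted)  =
      ~L∉C (refute-asserts⁻ (subst (Asserted (refute C)) (sym (~-involutive L)) asserted))
    ¬true (inj₂ evaluates) = refute-¬evaluates {C} {L} evaluates

  -- A model witnessing feasibility would satisfy the complement of every literal of `D`, whereas
  -- validity makes some literal of `C` true in it.
  refute-infeasible : ∀ {C D} → T⊨ C → C ⊆ D → Infeasible (refute D)
  refute-infeasible T⊨C C⊆D (_ , A , A⊨T , v , _ , satisfies) with find (T⊨C A A⊨T v)
  ... | L , L∈C , L-true =
    eval-~ A v L L-true (satisfies (~ L) (inj₁ (refute-asserts⁺ (C⊆D L∈C))))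

  -- Learning a substitute for a single clause.

  module _ (input : List Clause) (Basis : List Constraint) (X : Explanation Basis) where
    open MCSAT input Basis X
    open Explanation X

    ~∈ᴮ : ∀ L → L ∈ᴮ Basis → ~ L ∈ᴮ Basis
    ~∈ᴮ L = subst (_∈ Basis) (sym (constraint-~ L))

    -- The tail is decided first, since the head of a trail is its latest entry. The next literal is
    -- still undefined then: uniqueness excludes that it was already falsified, and the absence of
    -- complementary pairs that it was already satisfied.
    decide-refute : ∀ {𝓛 C} → Unique C → ¬ Tautology C → All (_∈ᴮ Basis) C →
      Σ (⟨ [] , 𝓛 ⟩ ⟹* ⟨ refute C , 𝓛 ⟩) λ ρ → proofLength ρ ≡ length C
    decide-refute [] _ _ = ε , refl
    decide-refute {C = L ∷ C} (L∉C ∷ C!) ¬taut (L∈ᴮ ∷ C⊆ᴮ)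
      with decide-refute C! (¬taut ∘ tautology-mono there) C⊆ᴮ
    ... | ρ , |ρ|≡ =
      ρ ◅◅ (Decide (~∈ᴮ L L∈ᴮ) (refute-undef ~L∉C ~~L∉C) ◅ ε) ,
      trans (proofLength-◅◅ ρ _) (trans (+-comm _ 1) (cong suc |ρ|≡))
      where
      ~L∉C : ~ L ∉ C
      ~L∉C ~L∈C = ¬taut (L , here refl , there ~L∈C)
      ~~L∉C : ~ ~ L ∉ C
      ~~L∉C = subst (_∉ C) (sym (~-involutive L)) (All¬⇒¬Any L∉C)

    -- Runs start and end with the empty trail, so they can be chained; `grows` keeps earlier
    -- redundancies valid along the chain.
    record Learns (𝓛 : List Clause) (C : Clause) (b : ℕ) : Set (lsuc 0ℓ ⊔ ℓ) where
      constructor learns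
      field
        {𝓛′}      : List Clause
        grows     : clauses 𝓛 ⊆ clauses 𝓛′
        redundant : Redundant (clauses 𝓛′) C
        run       : ⟨ [] , 𝓛 ⟩ ⟹* ⟨ [] , 𝓛′ ⟩
        bound     : proofLength run ≤ b

    learns-redundant : ∀ {𝓛 C b} → Redundant (clauses 𝓛) C → Learns 𝓛 C b
    learns-redundant redundant = learns id redundant ε z≤n

    -- The common ending of both learning runs: decisions `ρ`, then a conflict reached by `σ`. The
    -- summand 2 pays for `Learn` and `Restart`.
    learns-conflict : ∀ {M 𝓛 E C n b} → E ⊆ C →
      (ρ : ⟨ [] , 𝓛 ⟩ ⟹* M) → proofLength ρ ≡ n →
      ∀ {M′} (σ : M ⟹* ⟨ M′ , 𝓛 ⟩⊩ E) → n + (proofLength σ + 2) ≤ b → Learns 𝓛 C b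
    learns-conflict {𝓛 = 𝓛} {E} {C} {b = b} E⊆C ρ refl σ bound with E ∈ᶜ? clauses 𝓛
    -- `Learn` is blocked here, but the clause present already subsumes `C`, so the empty run
    -- suffices.
    ... | yes E∈ᶜ = learns-redundant (inj₂ (Any.map
            (λ {D} (E≈D : E ≈ D) {K} → E⊆C ∘ ≈⇒⊇ {E} E≈D {K}) E∈ᶜ))
    ... | no E∉ᶜ  = learns (++⁺ʳ input there)
            (inj₂ (Any.++⁺ʳ input (here E⊆C)))
            (ρ ◅◅ σ ◅◅ (Learn E∉ᶜ ◅ Restart ◅ ε))
            (subst (_≤ b) (sym length≡) bound)
      where
      length≡ : proofLength (ρ ◅◅ σ ◅◅ (Learn E∉ᶜ ◅ Restart ◅ ε)) ≡
                proofLength ρ + (proofLength σ + 2)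
      length≡ = trans (proofLength-◅◅ ρ _) (cong (proofLength ρ +_) (proofLength-◅◅ σ _))

    covers-support : ∀ {C} → All (_∈ᴮ Basis) C → All (_∈ᴮ Basis) (support C)
    covers-support {C} = All-resp-⊇ (support⊆ C)

    learns-valid : ∀ {𝓛 C} → T⊨ C → All (_∈ᴮ Basis) C → Learns 𝓛 C (size C + 5)
    learns-valid {𝓛} {C} T⊨C C⊆ᴮ with tautology? C
    ... | yes taut = learns-redundant (inj₁ taut)
    ... | no ¬taut
      with decide-refute {𝓛} (support! C) (¬taut ∘ tautology-mono (support⊆ C)) (covers-support C⊆ᴮ)
    -- `T-Conflict`, `Learn` and `Restart` cost 3; this is relaxed to 5, the cost for a resolvent.
    ...   | ρ , |ρ|≡ = learns-conflict E⊆C ρ |ρ|≡ (T-Conflict infeasible ◅ ε)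
              (+-monoʳ-≤ (size C) (m≤m+n 3 2))
      where
      M = refute (support C)

      infeasible : Infeasible M
      infeasible = refute-infeasible T⊨C (⊆support C)

      asserted-∈ᴮ : ∀ L → Asserted M L → L ∈ᴮ Basis
      asserted-∈ᴮ L asserted = subst (_∈ᴮ Basis) (~-involutive L)
        (~∈ᴮ (~ L) (All.lookup (covers-support C⊆ᴮ) (refute-asserts⁻
          (subst (Asserted M) (sym (~-involutive L)) asserted))))

      -- The explanation is false on `M`, and only literals of `C` are false there. So whatever
      -- clause `explain` picks, it subsumes `C`.
      E⊆C : explain M ⊆ C
      E⊆C L∈E = support⊆ C (refute-false⁻
        (All.lookup (proj₁ (proj₂ (explains M asserted-∈ᴮ infeasible))) L∈E))

    -- If the pivot or its complement occurs in the resolvent, one premise is already contained in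
    -- it. Otherwise the pivot is undefined once the resolvent is refuted, and propagating it
    -- falsifies the second premise.
    learns-resolvent : ∀ {𝓛 C D l} → All (_∈ᴮ Basis) (C ++ D) →
      Redundant (clauses 𝓛) (l ∷ C) → Redundant (clauses 𝓛) (~ l ∷ D) →
      Learns 𝓛 (C ++ D) (size (C ++ D) + 5)
    learns-resolvent {𝓛} {C} {D} {l} CD⊆ᴮ red₁ red₂
      with tautology? (C ++ D) | l ∈? (C ++ D) | ~ l ∈? (C ++ D)
    ... | yes taut | _ | _ = learns-redundant (inj₁ taut)
    ... | no _ | yes l∈CD | _ = learns-redundant (redundant-mono l∷C⊆CD red₁)
      where
      l∷C⊆CD : l ∷ C ⊆ C ++ D
      l∷C⊆CD (here refl) = l∈CD
      l∷C⊆CD (there K∈C) = ∈-++⁺ˡ K∈C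
    ... | no _ | no _ | yes ~l∈CD = learns-redundant (redundant-mono ~l∷D⊆CD red₂)
      where
      ~l∷D⊆CD : ~ l ∷ D ⊆ C ++ D
      ~l∷D⊆CD (here refl) = ~l∈CD
      ~l∷D⊆CD (there K∈D) = ∈-++⁺ʳ C K∈D
    ... | no ¬taut | no l∉CD | no ~l∉CD = resolvent red₁ red₂
      where
      M = refute (support (C ++ D))

      false : ∀ {E} → E ⊆ C ++ D → All (IsFalse M) E
      false E⊆CD = All.tabulate (inj₁ ∘ refute-asserts⁺ ∘ ⊆support (C ++ D) ∘ E⊆CD)

      undef : IsUndef M l
      undef = refute-undef (l∉CD ∘ support⊆ (C ++ D)) (~l∉CD ∘ support⊆ (C ++ D))

      from-premises : ∀ {E F} → E ∈ clauses 𝓛 → F ∈ clauses 𝓛 →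
        E ⊆ l ∷ C → F ⊆ ~ l ∷ D → Learns 𝓛 (C ++ D) (size (C ++ D) + 5)
      from-premises {E} {F} E∈ F∈ E⊆ F⊆ with l ∈? E | ~ l ∈? F
      -- A subsuming clause without its pivot literal lies within the resolvent, so nothing needs to
      -- be learned.
      ... | no l∉E  | _       =
        learns-redundant (inj₂ (lose E∈ (∈-++⁺ˡ ∘ ⊆∷∧∉⇒⊆ E⊆ l∉E)))
      ... | yes _   | no ~l∉F =
        learns-redundant (inj₂ (lose F∈ (∈-++⁺ʳ C ∘ ⊆∷∧∉⇒⊆ F⊆ ~l∉F)))
      ... | yes l∈E | yes ~l∈F
        with decide-refute {𝓛} (support! (C ++ D))
               (¬taut ∘ tautology-mono (support⊆ (C ++ D))) (covers-support CD⊆ᴮ)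
      ...   | ρ , |ρ|≡ = learns-conflict resolvent⊆ ρ |ρ|≡
                (Propagate E′∈ᶜ (false (∈-++⁺ˡ ∘ E∖l⊆C)) undef
                  ◅ Conflict (∈⇒∈ᶜ F∈) F-false
                  ◅ Resolve ~l∈F
                  ◅ ε)
                ≤-refl
        where
        E∖l⊆C : E ∖ l ⊆ C
        E∖l⊆C = ⊆∷⇒∖⊆ {E} E⊆

        -- `Propagate` expects the propagated literal at the head and a false tail, so all
        -- occurrences of `l` are gathered in front; `≈` permits this.
        E′ = l ∷ (E ∖ l)

        E′∈ᶜ : E′ ∈ᶜ clauses 𝓛
        E′∈ᶜ = ∈ᶜ-resp-≈ {E} {E′} (≈∷∖ l∈E) (∈⇒∈ᶜ E∈)

        F-false : All (IsFalse (propagate E′ l ∷ M)) F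
        F-false = All.tabulate λ K∈F → literal-false (F⊆ K∈F)
          where
          literal-false : ∀ {K} → K ∈ ~ l ∷ D → IsFalse (propagate E′ l ∷ M) K
          literal-false (here refl) = inj₁ (here
            (subst (λ L → Asserts L (propagate E′ l)) (sym (~-involutive l)) propagated))
          literal-false (there K∈D) =
            inj₁ (there (refute-asserts⁺ (⊆support (C ++ D) (∈-++⁺ʳ C K∈D))))

        resolvent⊆ : resolve F E′ l ⊆ C ++ D
        resolvent⊆ K∈R with ∈-++⁻ (F ∖ ~ l) K∈R
        ... | inj₁ K∈F∖~l = ∈-++⁺ʳ C (⊆∷⇒∖⊆ {F} F⊆ K∈F∖~l)
        ... | inj₂ K∈E′∖l = ∈-++⁺ˡ (⊆∷⇒∖⊆ {E′} (∷⁺ʳ l E∖l⊆C) K∈E′∖l)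

      resolvent : Redundant (clauses 𝓛) (l ∷ C) → Redundant (clauses 𝓛) (~ l ∷ D) →
        Learns 𝓛 (C ++ D) (size (C ++ D) + 5)
      -- A tautological premise would make the resolvent tautological or put a pivot literal into
      -- it; both are excluded in this case.
      resolvent (inj₁ taut) _ with tautology-∷ taut
      ... | inj₁ C-taut = contradiction (tautology-mono ∈-++⁺ˡ C-taut) ¬taut
      ... | inj₂ ~l∈C   = contradiction (∈-++⁺ˡ ~l∈C) ~l∉CD
      resolvent (inj₂ _) (inj₁ taut) with tautology-∷ taut
      ... | inj₁ D-taut = contradiction (tautology-mono (∈-++⁺ʳ C) D-taut) ¬taut
      ... | inj₂ ~~l∈D  =
        contradiction (∈-++⁺ʳ C (subst (_∈ D) (~-involutive l) ~~l∈D)) l∉CD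
      resolvent (inj₂ E∈) (inj₂ F∈) with find E∈ | find F∈
      ... | _ , E∈𝒞 , E⊆ | _ , F∈𝒞 , F⊆ = from-premises E∈𝒞 F∈𝒞 E⊆ F⊆

    -- Induction along the Res*(T) proof.

    Represents : ℕ → List Clause → List Clause → Set
    Represents k 𝒞 φ = All (λ C → size C ≤ k → Redundant 𝒞 C) φ

    represents-∈ᶜ : ∀ {k 𝒞 φ C} → Represents k 𝒞 φ → C ∈ᶜ φ → size C ≤ k → Redundant 𝒞 C
    represents-∈ᶜ {C = C} represents C∈φ |C|≤k with find C∈φ
    ... | D , D∈φ , C≈D = redundant-mono D⊆C
            (All.lookup represents D∈φ (≤-trans (size-mono D⊆C) |C|≤k))
      where
      D⊆C : D ⊆ C
      D⊆C = ≈⇒⊇ {C} C≈D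

    -- Here `k` counts the steps left after this one. A premise has at most one distinct literal
    -- more than the resolvent, so it falls under the bound `suc k` and has a substitute.
    simulate-step : ∀ {k φ 𝓛 C} → φ ⊢ C ∷ φ → Represents (suc k) (clauses 𝓛) φ →
      All (_∈ᴮ Basis) C → size C ≤ k → Learns 𝓛 C (size C + 5)
    simulate-step {k} (resolution {C} {D} {l} C∈φ D∈φ) represents CD⊆ᴮ |CD|≤k =
      learns-resolvent {C = C} CD⊆ᴮ
        (represents-∈ᶜ represents C∈φ (premise-size l (xs⊆xs++ys C D)))
        (represents-∈ᶜ represents D∈φ (premise-size (~ l) (xs⊆ys++xs D C)))
      where
      premise-size : ∀ L {E} → E ⊆ C ++ D → size (L ∷ E) ≤ suc k
      premise-size L {E} E⊆CD =
        ≤-trans (size-∷ L E) (s≤s (≤-trans (size-mono E⊆CD) |CD|≤k))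
    simulate-step (strong-theory-derivation T⊨C) _ C⊆ᴮ _ = learns-valid T⊨C C⊆ᴮ

    represents-step : ∀ {k 𝒞 𝒟 φ C} → 𝒞 ⊆ 𝒟 → Represents (suc k) 𝒞 φ →
      (size C ≤ k → Redundant 𝒟 C) → Represents k 𝒟 (C ∷ φ)
    represents-step 𝒞⊆𝒟 represents C-redundant =
      C-redundant ∷ All.map (λ r |D|≤k → redundant-⊆ 𝒞⊆𝒟 (r (m≤n⇒m≤1+n |D|≤k))) represents

    ⊢-extends : ∀ {φ ψ} → φ ⊢ ψ → ∃[ C ] ψ ≡ C ∷ φ
    ⊢-extends (resolution _ _)             = _ , refl
    ⊢-extends (strong-theory-derivation _) = _ , refl

    ⊢*⇒⊆ : ∀ {φ ψ} → φ ⊢* ψ → φ ⊆ ψ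
    ⊢*⇒⊆ ε = id
    ⊢*⇒⊆ (s ◅ π) with ⊢-extends s
    ... | _ , refl = ⊢*⇒⊆ π ∘ there

    -- The constant 2 pays for the final `Conflict` and `Unsat`. A step with `k` steps left after it
    -- costs at most `k + 5`, and summing over all `k` below `n` gives at most `5 * n + n * n`.
    bound : ℕ → ℕ
    bound = evalPoly (2 ∷ 5 ∷ 1 ∷ [])

    bound-suc : ∀ n → (n + 5) + bound n ≤ bound (suc n)
    bound-suc n = subst ((n + 5) + bound n ≤_) (sym (eq n)) (m≤m+n _ (suc n))
      where
      eq : ∀ n → 2 + (1 + n) * (5 + (1 + n) * (1 + (1 + n) * 0)) ≡
                 (n + 5) + (2 + n * (5 + n * (1 + n * 0))) + (1 + n)
      eq = solve-∀

    simulate : ∀ {φ ψ 𝓛} (π : φ ⊢* ψ) → Covers Basis ψ → [] ∈ᶜ ψ →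
      Represents (proofLength π) (clauses 𝓛) φ →
      Σ (⟨ [] , 𝓛 ⟩ ⟹* UNSAT) λ ρ → proofLength ρ ≤ bound (proofLength π)
    -- The empty clause has size 0, so it is represented even with no steps left. It is no
    -- tautology, and a clause subsuming it is itself empty.
    simulate ε _ []∈ψ represents with represents-∈ᶜ represents []∈ψ z≤n
    ... | inj₂ E∈ with find E∈
    ...   | E , E∈𝒞 , E⊆[] = Conflict []∈𝒞 [] ◅ Unsat ◅ ε , ≤-refl
      where
      []∈𝒞 = ∈ᶜ-resp-≈ {E} {[]} (⊆-antisym {E} {[]} E⊆[] λ ()) (∈⇒∈ᶜ E∈𝒞)
    simulate {φ} {𝓛 = 𝓛} (s ◅ π) covers []∈ψ represents with ⊢-extends s
    ... | C , refl with size C ≤? proofLength π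
    -- Too wide to matter in the remaining steps: MCSAT does nothing.
    ...   | no |C|≰k = proj₁ rest ,
              ≤-trans (proj₂ rest) (≤-trans (m≤n+m _ _) (bound-suc (proofLength π)))
      where
      rest = simulate π covers []∈ψ
        (represents-step id represents λ |C|≤k → contradiction |C|≤k |C|≰k)
    ...   | yes |C|≤k = run ◅◅ proj₁ rest ,
              subst (_≤ bound (suc (proofLength π))) (sym (proofLength-◅◅ run (proj₁ rest)))
                (≤-trans (+-mono-≤ (≤-trans run≤ (+-monoˡ-≤ 5 |C|≤k)) (proj₂ rest))
                  (bound-suc (proofLength π)))
      where
      open Learns (simulate-step s represents (All.lookup covers (⊢*⇒⊆ π (here refl))) |C|≤k)
        renaming (bound to run≤)
      rest = simulate π covers []∈ψ (represents-step grows represents λ _ → redundant)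

    input-represented : ∀ {k} → Represents k (clauses []) input
    input-represented = All.tabulate λ C∈ _ → inj₂ (lose (∈-++⁺ˡ C∈) id)

-- From MCSAT to Res*(T): an invariant of MCSAT states.

module Res*SimulatesMCSAT {ℓ : Level} {S : Signature} (T : Theory S ℓ) where
  open ProofSystems T
  open ClauseProperties S

  module _ (input : List Clause) (Basis : List Constraint) (X : Explanation Basis) where
    open MCSAT input Basis X
    open Explanation X

    Derived : List Clause → Clause → Set
    Derived φ C = C ∈ᶜ φ × All (_∈ᴮ Basis) C

    -- Asserted literals are kept in `Basis` because `explains` speaks only of such trails. A reason
    -- from `Propagate` or `Backjump` contains its literal; one from `T-Propagate` is instead
    -- recorded as valid.
    data Justified (φ : List Clause) : Entry → Set (lsuc 0ℓ ⊔ ℓ) where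
      decide    : ∀ {L} → L ∈ᴮ Basis → Justified φ (decide L)
      propagate : ∀ {D L} → L ∈ᴮ Basis → Derived φ D → L ∈ D ⊎ T⊨ D →
        Justified φ (propagate D L)
      theory    : ∀ {x α} → Justified φ (x ↦ α)

    data Invariant (φ : List Clause) : State → Set (lsuc 0ℓ ⊔ ℓ) where
      search   : ∀ {M 𝓛} → All (Justified φ) M → All (Derived φ) (clauses 𝓛) →
        Invariant φ ⟨ M , 𝓛 ⟩
      conflict : ∀ {M 𝓛 C} → All (Justified φ) M → All (Derived φ) (clauses 𝓛) →
        Derived φ C → Invariant φ (⟨ M , 𝓛 ⟩⊩ C)
      sat      : Invariant φ SAT
      unsat    : [] ∈ᶜ φ → Invariant φ UNSAT

    derived-∈ᶜ : ∀ {φ 𝒞 C} → All (Derived φ) 𝒞 → C ∈ᶜ 𝒞 → Derived φ C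
    derived-∈ᶜ {C = C} derived C∈𝒞 with find C∈𝒞
    ... | D , D∈𝒞 , C≈D with All.lookup derived D∈𝒞
    ...   | D∈φ , D⊆ᴮ =
      ∈ᶜ-resp-≈ {D} {C} (≈-sym {C} {D} C≈D) D∈φ , All-resp-⊇ (≈⇒⊆ C≈D) D⊆ᴮ

    derived-∷ : ∀ {φ C D} → Derived φ C → Derived (D ∷ φ) C
    derived-∷ (C∈φ , C⊆ᴮ) = there C∈φ , C⊆ᴮ

    justified-∷ : ∀ {φ D e} → Justified φ e → Justified (D ∷ φ) e
    justified-∷ (decide L∈ᴮ)             = decide L∈ᴮ
    justified-∷ (propagate L∈ᴮ D reason) = propagate L∈ᴮ (derived-∷ D) reason
    justified-∷ theory                   = theory

    asserted-∈ᴮ : ∀ {φ M} → All (Justified φ) M → ∀ L → Asserted M L → L ∈ᴮ Basis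
    asserted-∈ᴮ (decide L∈ᴮ ∷ _)        L (here decided)    = L∈ᴮ
    asserted-∈ᴮ (propagate L∈ᴮ _ _ ∷ _) L (here propagated) = L∈ᴮ
    asserted-∈ᴮ (_ ∷ M)                 L (there asserted)  = asserted-∈ᴮ M L asserted

    explain-derived : ∀ {φ M} → All (Justified φ) M → Infeasible M →
      T⊨ explain M × Derived (explain M ∷ φ) (explain M)
    explain-derived {M = M} justified infeasible
      with explains M (asserted-∈ᴮ justified) infeasible
    ... | T⊨E , _ , E⊆ᴮ = T⊨E , here (≈-refl {explain M}) , E⊆ᴮ

    Simulated : List Clause → State → Set (lsuc 0ℓ ⊔ ℓ)
    Simulated φ s = ∃[ ψ ] Σ (φ ⊢* ψ) λ π → proofLength π ≤ 1 × Invariant ψ s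

    stay : ∀ {φ s} → Invariant φ s → Simulated φ s
    stay inv = _ , ε , z≤n , inv

    derive : ∀ {φ ψ s} → φ ⊢ ψ → Invariant ψ s → Simulated φ s
    derive step inv = _ , step ◅ ε , ≤-refl , inv

    resolve-derived : ∀ {φ M 𝓛 C D L} → ~ L ∈ C →
      All (Justified φ) M → All (Derived φ) (clauses 𝓛) → Derived φ C →
      Derived φ D → L ∈ D ⊎ T⊨ D → Simulated φ (⟨ M , 𝓛 ⟩⊩ resolve C D L)
    resolve-derived {φ} {M} {𝓛} {C} {D} {L} ~L∈C justified derived (C∈φ , C⊆ᴮ) (D∈φ , D⊆ᴮ) reason
      with L ∈? D | reason
    -- The pivot is `~ L`, with `C` as first premise, so that the conclusion is literally
    -- `resolve C D L`; the second premise then needs `~ ~ L` rewritten to `L`.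
    ... | yes L∈D | _        = derive (resolution {l = ~ L} C′∈φ D′∈φ) resolved
      where
      resolved : Invariant (resolve C D L ∷ φ) (⟨ M , 𝓛 ⟩⊩ resolve C D L)
      resolved = conflict (All.map justified-∷ justified) (All.map derived-∷ derived)
        (here (≈-refl {resolve C D L}) ,
         All.++⁺ (All-resp-⊇ (∖⊆ C (~ L)) C⊆ᴮ) (All-resp-⊇ (∖⊆ D L) D⊆ᴮ))
      C′∈φ : (~ L ∷ (C ∖ ~ L)) ∈ᶜ φ
      C′∈φ = ∈ᶜ-resp-≈ {C} (≈∷∖ ~L∈C) C∈φ
      D′∈φ : (~ ~ L ∷ (D ∖ L)) ∈ᶜ φ
      D′∈φ = subst (λ K → (K ∷ (D ∖ L)) ∈ᶜ φ) (sym (~-involutive L))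
        (∈ᶜ-resp-≈ {D} (≈∷∖ L∈D) D∈φ)
    ... | no L∉D  | inj₁ L∈D = contradiction L∈D L∉D
    ... | no L∉D  | inj₂ T⊨D = derive
        (strong-theory-derivation λ A A⊨T v → Any-resp-⊆ D⊆R (T⊨D A A⊨T v))
        (conflict (All.map justified-∷ justified) (All.map derived-∷ derived)
          (here (≈-refl {resolve C D L}) ,
           All.++⁺ (All-resp-⊇ (∖⊆ C (~ L)) C⊆ᴮ) (All-resp-⊇ (∖⊆ D L) D⊆ᴮ)))
      where
      D⊆R : D ⊆ resolve C D L
      D⊆R = ∈-++⁺ʳ (C ∖ ~ L) ∘ ⊆∷∧∉⇒⊆ (⊆∷∖ D L) L∉D

    head-∈ : ∀ {C Ls L} → C ≈ L ∷ Ls → L ∈ C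
    head-∈ {C} {Ls} {L} C≈ = ≈⇒⊇ {C} C≈ (here refl)

    -- Only `T-Propagate`, `T-Conflict` and `Resolve` bring in a clause that may be new, and each
    -- costs one step. All other rules move or discard clauses already in `φ`.
    simulate-step : ∀ {φ s t} → Invariant φ s → s ⟹ t → Simulated φ t
    simulate-step (search M 𝒞) (Decide L∈ᴮ _) = stay (search (decide L∈ᴮ ∷ M) 𝒞)
    simulate-step (search M 𝒞) (Propagate C∈𝒞 _ _) =
      let C = derived-∈ᶜ 𝒞 C∈𝒞 in
      stay (search (propagate (All.head (proj₂ C)) C (inj₁ (here refl)) ∷ M) 𝒞)
    simulate-step (search M 𝒞) (Conflict C∈𝒞 _) = stay (conflict M 𝒞 (derived-∈ᶜ 𝒞 C∈𝒞))
    simulate-step (search M 𝒞) (Sat _ _) = stay sat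
    -- `φ` keeps the forgotten clause, so reasons on the trail that refer to it stay derived.
    simulate-step (search M 𝒞) (Forget C∈𝓛) =
      stay (search M (All.++⁺ (All.++⁻ˡ input 𝒞) (All.─⁺ C∈𝓛 (All.++⁻ʳ input 𝒞))))
    simulate-step (search M 𝒞) (T-Propagate {L = L} L∈ᴮ _ infeasible) =
      let ~L∈ᴮ = subst (_∈ Basis) (sym (constraint-~ L)) L∈ᴮ
          T⊨E , E = explain-derived (decide ~L∈ᴮ ∷ M) infeasible in
      derive (strong-theory-derivation T⊨E)
        (search (propagate L∈ᴮ E (inj₂ T⊨E) ∷ All.map justified-∷ M) (All.map derived-∷ 𝒞))
    simulate-step (search M 𝒞) (T-Decide _ _ _) = stay (search (theory ∷ M) 𝒞)
    simulate-step (search M 𝒞) (T-Conflict infeasible) =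
      let T⊨E , E = explain-derived M infeasible in
      derive (strong-theory-derivation T⊨E)
        (conflict (All.map justified-∷ M) (All.map derived-∷ 𝒞) E)
    simulate-step (conflict M 𝒞 C) Restart = stay (search [] 𝒞)
    simulate-step (conflict (propagate _ D reason ∷ M) 𝒞 C) (Resolve ~L∈C) =
      resolve-derived ~L∈C M 𝒞 C D reason
    simulate-step (conflict (_ ∷ M) 𝒞 C) (Consume₁ _) = stay (conflict M 𝒞 C)
    simulate-step (conflict (_ ∷ M) 𝒞 C) (Consume₂ _) = stay (conflict M 𝒞 C)
    simulate-step (conflict M 𝒞 C) (Backjump {N = N} {C = D} {Ls} {L} _ C≈ _ _) =
      let L∈C = head-∈ {D} {Ls} {L} C≈ in
      stay (search
        (propagate (All.lookup (proj₂ C) L∈C) C (inj₁ L∈C) ∷ All.tail (All.++⁻ʳ N M)) 𝒞)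
    simulate-step (conflict M 𝒞 C) Unsat = stay (unsat (proj₁ C))
    simulate-step (conflict M 𝒞 C) (Learn _) =
      stay (conflict M (All.++⁺ (All.++⁻ˡ input 𝒞) (C ∷ All.++⁻ʳ input 𝒞)) C)
    simulate-step (conflict (_ ∷ M) 𝒞 C) (T-Consume _) = stay (conflict M 𝒞 C)
    simulate-step (conflict M 𝒞 C) (T-Backjump-Decide {N = N} {C = D} {Ls = Ls} {L} C≈ _ _ _) =
      stay (search
        (decide (All.lookup (proj₂ C) (head-∈ {D} {Ls} {L} C≈)) ∷ All.tail (All.++⁻ʳ N M)) 𝒞)

    simulate : ∀ {φ s} → Invariant φ s → (ρ : s ⟹* UNSAT) →
      Σ (Res*Proof φ) λ π → Res*Length π ≤ proofLength ρ
    simulate (unsat []∈φ) ε = (_ , ε , []∈φ) , z≤n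
    simulate inv (step ◅ ρ) with simulate-step inv step
    ... | _ , π₁ , |π₁|≤1 , inv′ with simulate inv′ ρ
    ...   | (_ , π₂ , []∈ψ) , |π₂|≤ =
      (_ , π₁ ◅◅ π₂ , []∈ψ) ,
      subst (_≤ suc (proofLength ρ)) (sym (proofLength-◅◅ π₁ π₂)) (+-mono-≤ |π₁|≤1 |π₂|≤)

    initial : Covers Basis input → Invariant input ⟨ [] , [] ⟩
    initial covers = search [] (All.++⁺
      (All.tabulate λ C∈ → ∈⇒∈ᶜ C∈ , All.lookup covers C∈) [])

theorem1 : {ℓ : Level} (S : Signature) (T : Theory S ℓ) → let open ProofSystems T in
    (∃[ p ] ((φ : List Clause) (π : Res*Proof φ)
    (Basis : List Constraint) → Covers Basis (Res*Clauses π) → (X : Explanation Basis) →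
    ∃[ ρ ] MCSATLength {φ} {Basis} {X} ρ ≤ evalPoly p (Res*Length π)))
    ×
    (∃[ q ] ((φ : List Clause)
    (Basis : List Constraint) → Covers Basis φ → (X : Explanation Basis)
    (ρ : MCSATProof φ Basis X) →
    ∃[ π ] Res*Length {φ} π ≤ evalPoly q (MCSATLength {φ} {Basis} {X} ρ)))
theorem1 S T =
  (2 ∷ 5 ∷ 1 ∷ [] , λ φ (_ , π , []∈ψ) Basis covers X →
    let open MCSATSimulatesRes* T in
    simulate φ Basis X π covers []∈ψ (input-represented φ Basis X)) ,
  -- The identity polynomial, as every MCSAT step costs at most one Res*(T) step.
  (0 ∷ 1 ∷ [] , λ φ Basis covers X ρ →
    let open ProofSystems T using (Res*Length)
        open Res*SimulatesMCSAT T
        π , |π|≤|ρ| = simulate φ Basis X (initial φ Basis X covers) ρ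
    in π , subst (Res*Length π ≤_) (linear (proofLength ρ)) |π|≤|ρ|)
  where
  linear : ∀ n → n ≡ n * (1 + n * 0)
  linear = solve-∀
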